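{- There is a constant $c>0$ such that for every positive integer $n$ there exists an $n$-component monotone network $f:\{0,1\}^n\to\{0,1\}^n$ whose fixing length satisfies $\lambda(f)\ge c\,n^2$.
   Context: An $n$-component (Boolean) network is a function $f=(f_1,\dots,f_n):\{0,1\}^n\to\{0,1\}^n$. Write $[n]=\{1,\dots,n\}$. For $i\in[n]$ and $x\in\{0,1\}^n$, $f^i(x):=(x_1,\dots,x_{i-1},f_i(x),x_{i+1},\dots,x_n)$. For a word $w=i_1i_2\dots i_k$ over the alphabet $[n]$, $f^w:=f^{i_k}\circ\cdots\circ f^{i_1}$ (and $f^\epsilon=\mathrm{id}$ for the empty word $\epsilon$). A word $w$ fixes $f$ if $f^w(x)$ is a fixed point of $f$ for every $x\in\{0,1\}^n$; $f$ is fixable if some word fixes it, and then the fixing length $\lambda(f)$ is the minimum length of a word fixing $f$. The order on $\{0,1\}^n$ is componentwise: $x\le y$ iff $x_i\le y_i$ for all $i\in[n]$. The network $f$ is monotone if $x\le y$ implies $f(x)\le f(y)$ for all $x,y$. (Monotone networks are known to be fixable, so $\lambda(f)$ is defined.) -}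

module Defs where

open import Data.Bool.Base using (Bool; _≤_)
open import Data.Fin.Base using (Fin)
open import Data.List.Base using (List; []; _∷_; length)
open import Data.Nat.Base as ℕ using (ℕ)
open import Data.Product.Base using (∃-syntax; _×_)
open import Data.Vec.Base using (Vec; lookup; _[_]≔_)
open import Relation.Binary.PropositionalEquality.Core using (_≡_)

Config : ℕ → Set
Config n = Vec Bool n

Network : ℕ → Set
Network n = Config n → Config n

Word : ℕ → Set
Word n = List (Fin n)

infix 4 _⊑_
_⊑_ : ∀ {n} → Config n → Config n → Set
x ⊑ y = ∀ i → lookup x i ≤ lookup y i

Monotone : ∀ {n} → Network n → Set
Monotone f = ∀ x y → x ⊑ y → f x ⊑ f y

FixedPoint : ∀ {n} → Network n → Config n → Set
FixedPoint f x = f x ≡ x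

update : ∀ {n} → Network n → Fin n → Network n
update f i x = x [ i ]≔ lookup (f x) i

-- The leftmost letter of the word is applied first.
updates : ∀ {n} → Network n → Word n → Network n
updates f []      x = x
updates f (i ∷ w) x = updates f w (update f i x)

Fixes : ∀ {n} → Word n → Network n → Set
Fixes w f = ∀ x → FixedPoint f (updates f w x)

-- The fixing length λ(f) is a partial function of f (defined only for fixable
-- f), so it is given by its graph: `IsFixingLength f ℓ` says that f is fixable
-- and λ(f) = ℓ.
IsFixingLength : ∀ {n} → Network n → ℕ → Set
IsFixingLength {n} f ℓ =
  (∃[ w ] (Fixes w f × length w ≡ ℓ)) ×
  (∀ (w : Word n) → Fixes w f → ℓ ℕ.≤ length w)

{-# OPTIONS --safe #-}
-- For a sequence s of distinct letters, chain s is the monotone network in which the components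
-- listed in s can only be switched on one after the other: started from the zero configuration, a
-- word fixes it only if it contains s as a subsequence.  Given finitely many words of length at most
-- q², over 4q letters, a letter avoiding both the letters already used and the next q letters of
-- at least half of the words can be found by averaging; iterating this q + 1 times yields an s which
-- is not a subsequence of at least a fraction 2^-(q+1) of the words.  Hence 2^O(q) sequences suffice
-- so that every word of length at most q² misses one of them.  A binary tree of multiplexers, driven
-- by O(q) control components that never change, combines the corresponding networks into a single
-- monotone one with O(q) components, which no word of length at most q² fixes.
module Submission where

open import Defs
open import Data.Bool.Base as Bool using (Bool; true; false; _∧_; _∨_; f≤t; b≤b)
import Data.Bool.Properties as Bool
open import Data.Fin.Base using (Fin; zero; suc)
open import Data.Fin.Properties using (_≟_; any?)
open import Data.Fin.Subset using (_⊂_; _⊃_)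
open import Data.Fin.Subset.Induction using (Acc; acc; ⊂-wellFounded; ⊃-wellFounded)
open import Data.Integer.Base as ℤ using (+_)
import Data.Integer.Properties as ℤ
open import Data.List.Base
  using (List; []; _∷_; _++_; _ʳ++_; length; map; filter; take; concatMap; cartesianProductWith; allFin)
import Data.List.Membership.DecPropositional as DecMembership
open import Data.List.Membership.Propositional using (_∈_; _∉_)
open import Data.List.Membership.Propositional.Properties
  using (∈-++⁺ˡ; ∈-++⁺ʳ; ∈-map⁺; ∈-filter⁺; ∈-filter⁻; ∈-cartesianProductWith⁺; ∈-allFin)
open import Data.List.Properties using (length-++; length-map; length-take; length-tabulate; filter-++)
import Data.List.Relation.Binary.Sublist.DecPropositional as DecSublist
open import Data.List.Relation.Binary.Sublist.Propositional using (_⊆_; []; _∷_; _∷ʳ_; minimum)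
open import Data.List.Relation.Binary.Sublist.Propositional.Properties using (∷ˡ⁻)
open import Data.List.Relation.Unary.All as All using (All; []; _∷_)
import Data.List.Relation.Unary.All.Properties as All
open import Data.List.Relation.Unary.Any using (here; there)
open import Data.Nat.Base as ℕ
open import Data.Nat.DivMod using (m≡m%n+[m/n]*n; m%n<n)
open import Data.Nat.Properties hiding (_≟_)
open import Data.Nat.Tactic.RingSolver using (solve-∀)
open import Data.Product.Base using (∃-syntax; Σ-syntax; _×_; _,_; proj₁; proj₂)
open import Data.Rational.Base as ℚ using (0ℚ)
import Data.Rational.Properties as ℚ
import Data.Rational.Unnormalised.Base as ℚᵘ
import Data.Rational.Unnormalised.Properties as ℚᵘ
open import Data.Sum.Base using (_⊎_; inj₁; inj₂)
open import Data.Vec.Base as Vec using (Vec; []; _∷_; lookup; zipWith; tabulate)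
import Data.Vec.Properties as Vec
open import Function.Base using (_∘_)
open import Relation.Binary.PropositionalEquality hiding ([_])
open import Relation.Nullary using (¬_; Dec; yes; no; contradiction; does)
open import Relation.Nullary.Decidable using (map′; ¬?; decidable-stable)
open import Relation.Unary using (Decidable)

private
  variable
    m n : ℕ

-- Fixability of monotone networks

lookup-extensional : ∀ {A : Set} {x y : Vec A n} → (∀ i → lookup x i ≡ lookup y i) → x ≡ y
lookup-extensional {x = x} {y} x≗y =
  trans (sym (Vec.tabulate∘lookup x)) (trans (Vec.tabulate-cong x≗y) (Vec.tabulate∘lookup y))

≤-true : ∀ {a b} → a Bool.≤ b → a ≡ true → b ≡ true
≤-true b≤b a≡true = a≡true

≰⇒true : ∀ {a b} → ¬ a Bool.≤ b → a ≡ true × b ≡ false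
≰⇒true {false} {false} a≰b = contradiction b≤b a≰b
≰⇒true {false} {true}  a≰b = contradiction f≤t a≰b
≰⇒true {true}  {false} _   = refl , refl
≰⇒true {true}  {true}  a≰b = contradiction b≤b a≰b

≤∧≢⇒false : ∀ {a b} → a Bool.≤ b → a ≢ b → a ≡ false × b ≡ true
≤∧≢⇒false f≤t _   = refl , refl
≤∧≢⇒false b≤b a≢a = contradiction refl a≢a

⊑-⊂ : ∀ {x y : Config n} i → x ⊑ y → lookup x i ≡ false → lookup y i ≡ true → x ⊂ y
⊑-⊂ {x = x} {y} i x⊑y xᵢ yᵢ =
  (λ {j} j∈x → Vec.lookup⇒[]= j y (≤-true (x⊑y j) (Vec.[]=⇒lookup j∈x))) ,
  i , Vec.lookup⇒[]= i y yᵢ , λ i∈x → contradiction (trans (sym xᵢ) (Vec.[]=⇒lookup i∈x)) λ ()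

lookup-update : (f : Network n) (i j : Fin n) (x : Config n) →
  (i ≡ j × lookup (update f i x) j ≡ lookup (f x) j) ⊎ (i ≢ j × lookup (update f i x) j ≡ lookup x j)
lookup-update f i j x with i ≟ j
... | yes refl = inj₁ (refl , Vec.lookup∘update i x _)
... | no i≢j   = inj₂ (i≢j , Vec.lookup∘update′ (i≢j ∘ sym) x _)

updates-++ : (f : Network n) (u v : Word n) (x : Config n) →
  updates f (u ++ v) x ≡ updates f v (updates f u x)
updates-++ f []      v x = refl
updates-++ f (i ∷ u) v x = updates-++ f u v (update f i x)

update-fixed : (f : Network n) (i : Fin n) {x : Config n} → FixedPoint f x → update f i x ≡ x
update-fixed f i {x} fx≡x rewrite fx≡x = Vec.[]≔-lookup x i

updates-fixed : (f : Network n) (w : Word n) {x : Config n} → FixedPoint f x → updates f w x ≡ x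
updates-fixed f []      _    = refl
updates-fixed f (i ∷ w) fx≡x rewrite update-fixed f i fx≡x = updates-fixed f w fx≡x

FixedPoint? : (f : Network n) → Decidable (FixedPoint f)
FixedPoint? f x = Vec.≡-dec Bool._≟_ (f x) x

module _ (f : Network n) (f-mono : Monotone f) where

  -- Updating a component that is on but has value false under `f` switches it off, so the set of
  -- true components shrinks. When no such component is left, the configuration lies below its
  -- image.
  descend : ∀ x → Acc _⊂_ x → ∃[ w ] updates f w x ⊑ f (updates f w x)
  descend x (acc rec) with any? (λ i → ¬? (lookup x i Bool.≤? lookup (f x) i))
  ... | no ∄i = [] , λ i → decidable-stable (lookup x i Bool.≤? lookup (f x) i) λ ≰ → ∄i (i , ≰)
  ... | yes (i , xᵢ≰) with xᵢ , fxᵢ ← ≰⇒true xᵢ≰ =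
    let w , p = descend (update f i x) (rec (⊑-⊂ i below (trans (Vec.lookup∘update i x _) fxᵢ) xᵢ))
    in i ∷ w , p
    where
    below : update f i x ⊑ x
    below j with lookup-update f i j x
    ... | inj₁ (refl , eq) rewrite eq | fxᵢ | xᵢ = f≤t
    ... | inj₂ (_ , eq)    rewrite eq = b≤b

  -- The invariant `x ⊑ f x` survives an update: the new point lies between `x` and `f x`, so by
  -- monotonicity its image lies above `f x`, hence above the new point. Each update made here
  -- switches a component on, so the process ends, at a fixed point.
  ascend : ∀ x → x ⊑ f x → Acc _⊃_ x → ∃[ w ] FixedPoint f (updates f w x)
  ascend x x⊑fx (acc rec) with any? (λ i → ¬? (lookup x i Bool.≟ lookup (f x) i))
  ... | no ∄i = [] , lookup-extensional λ i →
    sym (decidable-stable (lookup x i Bool.≟ lookup (f x) i) λ ≢ → ∄i (i , ≢))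
  ... | yes (i , xᵢ≢) with xᵢ , fxᵢ ← ≤∧≢⇒false (x⊑fx i) xᵢ≢ =
    let w , p = ascend (update f i x)
                  (λ j → Bool.≤-trans (under j) (f-mono x (update f i x) above j))
                  (rec (⊑-⊂ i above xᵢ (trans (Vec.lookup∘update i x _) fxᵢ)))
    in i ∷ w , p
    where
    above : x ⊑ update f i x
    above j with lookup-update f i j x
    ... | inj₁ (refl , eq) rewrite eq = x⊑fx i
    ... | inj₂ (_ , eq)    rewrite eq = b≤b
    under : update f i x ⊑ f x
    under j with lookup-update f i j x
    ... | inj₁ (refl , eq) rewrite eq = b≤b
    ... | inj₂ (_ , eq)    rewrite eq = x⊑fx j

  reaches-fixedPoint : ∀ x → ∃[ w ] FixedPoint f (updates f w x)
  reaches-fixedPoint x =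
    let u , p = descend x (⊂-wellFounded x)
        v , q = ascend (updates f u x) p (⊃-wellFounded _)
    in u ++ v , subst (FixedPoint f) (sym (updates-++ f u v x)) q

  -- One word serves several configurations because a fixed point is not moved by later letters:
  -- appending letters for `x` cannot spoil what was reached from `xs`.
  fixes-all : (xs : List (Config n)) → ∃[ w ] All (λ x → FixedPoint f (updates f w x)) xs
  fixes-all []       = [] , []
  fixes-all (x ∷ xs) =
    let u , ps = fixes-all xs
        v , p  = reaches-fixedPoint (updates f u x)
    in u ++ v ,
       subst (FixedPoint f) (sym (updates-++ f u v x)) p ∷
       All.map (λ {y} q → subst (FixedPoint f)
         (sym (trans (updates-++ f u v y) (updates-fixed f v q))) q) ps

configs : ∀ n → List (Config n)
configs zero    = [] ∷ []
configs (suc n) = map (false ∷_) (configs n) ++ map (true ∷_) (configs n)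

∈-configs : (x : Config n) → x ∈ configs n
∈-configs []          = here refl
∈-configs (false ∷ x) = ∈-++⁺ˡ (∈-map⁺ (false ∷_) (∈-configs x))
∈-configs (true ∷ x)  = ∈-++⁺ʳ (map (false ∷_) (configs _)) (∈-map⁺ (true ∷_) (∈-configs x))

Fixes? : (f : Network n) → Decidable (λ w → Fixes w f)
Fixes? f w = map′ (λ ps x → All.lookup ps (∈-configs x)) (λ fixes → All.tabulate λ {x} _ → fixes x)
  (All.all? (λ x → FixedPoint? f (updates f w x)) (configs _))

anyWord? : {P : Word n → Set} → Decidable P → ∀ l → Dec (∃[ w ] (P w × length w ≡ l))
anyWord? P? zero    = map′ (λ p → [] , p , refl) (λ { ([] , p , _) → p }) (P? [])
anyWord? P? (suc l) = map′
  (λ { (i , w , p , eq) → i ∷ w , p , cong suc eq })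
  (λ { (i ∷ w , p , refl) → i , w , p , refl })
  (any? λ i → anyWord? (P? ∘ (i ∷_)) l)

least : {P : ℕ → Set} → Decidable P → ∀ k → P k → ∃[ l ] (P l × (∀ j → P j → l ≤ j))
least P? zero    p = 0 , p , λ _ _ → z≤n
least P? (suc k) p with P? 0
... | yes p₀ = 0 , p₀ , λ _ _ → z≤n
... | no ¬p₀ =
  let l , q , l≤ = least (P? ∘ suc) k p
  in suc l , q , λ { zero p₀ → contradiction p₀ ¬p₀ ; (suc j) r → s≤s (l≤ j r) }

-- There are finitely many configurations, and finitely many words of each length, so having a
-- fixing word of a given length is decidable. The minimum is found by a search bounded by the
-- length of one known fixing word.
monotone⇒fixingLength : (f : Network n) → Monotone f → ∃[ l ] IsFixingLength f l
monotone⇒fixingLength f f-mono =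
  let w , fixes    = fixes-all f f-mono (configs _)
      l , p , l≤   = least (anyWord? (Fixes? f)) (length w)
                       (w , (λ x → All.lookup fixes (∈-configs x)) , refl)
  in l , p , λ v v-fixes → l≤ (length v) (v , v-fixes , refl)

_⊆?_ : (s w : Word n) → Dec (s ⊆ w)
_⊆?_ = DecSublist._⊆?_ _≟_

-- Multiplexers and chains

-- Component `zero` will be one that never changes, so its letters act trivially and can be deleted.
below : Word (suc n) → Word n
below []          = []
below (zero ∷ w)  = below w
below (suc i ∷ w) = i ∷ below w

length-below : (w : Word (suc n)) → length (below w) ≤ length w
length-below []          = z≤n
length-below (zero ∷ w)  = m≤n⇒m≤1+n (length-below w)
length-below (suc i ∷ w) = s≤s (length-below w)

pad : Network n → Network (suc n)
pad f (b ∷ x) = b ∷ f x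

pad-monotone : {f : Network n} → Monotone f → Monotone (pad f)
pad-monotone f-mono (b ∷ x) (c ∷ y) x⊑y zero    = x⊑y zero
pad-monotone f-mono (b ∷ x) (c ∷ y) x⊑y (suc i) = f-mono x y (x⊑y ∘ suc) i

updates-pad : (f : Network n) (w : Word (suc n)) (b : Bool) (x : Config n) →
  updates (pad f) w (b ∷ x) ≡ b ∷ updates f (below w) x
updates-pad f []          b x = refl
updates-pad f (zero ∷ w)  b x = updates-pad f w b x
updates-pad f (suc i ∷ w) b x = updates-pad f w b (update f i x)

fixes-pad : (f : Network n) (w : Word (suc n)) → Fixes w (pad f) → Fixes (below w) f
fixes-pad f w fixes x with p ← fixes (false ∷ x) rewrite updates-pad f w false x = Vec.∷-injectiveʳ p

-- A monotone multiplexer. A single selector bit would have to occur negated, so two controls are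
-- used: `true false` picks `a` and `false true` picks `b`.
mux : Bool → Bool → Bool → Bool → Bool
mux c d a b = (c ∧ a) ∨ (d ∧ b)

∧-mono : ∀ {a b c d} → a Bool.≤ b → c Bool.≤ d → a ∧ c Bool.≤ b ∧ d
∧-mono {d = d} f≤t _ = Bool.≤-minimum d
∧-mono {false} b≤b _ = b≤b
∧-mono {true}  b≤b p = p

∨-mono : ∀ {a b c d} → a Bool.≤ b → c Bool.≤ d → a ∨ c Bool.≤ b ∨ d
∨-mono {c = c} f≤t _ = Bool.≤-maximum c
∨-mono {false} b≤b p = p
∨-mono {true}  b≤b _ = b≤b

select : Network n → Network n → Network (2 + n)
select g h (c ∷ d ∷ x) = c ∷ d ∷ zipWith (mux c d) (g x) (h x)

select-monotone : {g h : Network n} → Monotone g → Monotone h → Monotone (select g h)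
select-monotone g-mono h-mono (_ ∷ _ ∷ x) (_ ∷ _ ∷ y) x⊑y zero          = x⊑y zero
select-monotone g-mono h-mono (_ ∷ _ ∷ x) (_ ∷ _ ∷ y) x⊑y (suc zero)    = x⊑y (suc zero)
select-monotone {g = g} {h} g-mono h-mono (a ∷ b ∷ x) (c ∷ d ∷ y) x⊑y (suc (suc i))
  rewrite Vec.lookup-zipWith (mux a b) i (g x) (h x) | Vec.lookup-zipWith (mux c d) i (g y) (h y)
  = ∨-mono (∧-mono (x⊑y zero) (g-mono x y (λ j → x⊑y (suc (suc j))) i))
           (∧-mono (x⊑y (suc zero)) (h-mono x y (λ j → x⊑y (suc (suc j))) i))

-- Treats both settings of the controls at once: `k` is whatever network remains when they are
-- frozen at `c` and `d`.
module Selected (g h : Network n) (c d : Bool) (k : Network n)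
                (selects : ∀ x → zipWith (mux c d) (g x) (h x) ≡ k x) where

  updates-select : (w : Word (2 + n)) (x : Config n) →
    updates (select g h) w (c ∷ d ∷ x) ≡ c ∷ d ∷ updates k (below (below w)) x
  updates-select []                x = refl
  updates-select (zero ∷ w)        x = updates-select w x
  updates-select (suc zero ∷ w)    x = updates-select w x
  updates-select (suc (suc i) ∷ w) x rewrite selects x = updates-select w (update k i x)

  fixes-select : (w : Word (2 + n)) → Fixes w (select g h) → Fixes (below (below w)) k
  fixes-select w fixes x with p ← fixes (c ∷ d ∷ x) rewrite updates-select w x =
    trans (sym (selects _)) (Vec.∷-injectiveʳ (Vec.∷-injectiveʳ p))

zipWith-mux-left : (x y : Config n) → zipWith (mux true false) x y ≡ x
zipWith-mux-left []      []      = refl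
zipWith-mux-left (a ∷ x) (_ ∷ y) = cong₂ _∷_ (Bool.∨-identityʳ a) (zipWith-mux-left x y)

zipWith-mux-right : (x y : Config n) → zipWith (mux false true) x y ≡ y
zipWith-mux-right []      []      = refl
zipWith-mux-right (_ ∷ x) (b ∷ y) = cong (b ∷_) (zipWith-mux-right x y)

fixes-select-left : (g h : Network n) (w : Word (2 + n)) →
  Fixes w (select g h) → Fixes (below (below w)) g
fixes-select-left g h =
  Selected.fixes-select g h true false g (λ x → zipWith-mux-left (g x) (h x))

fixes-select-right : (g h : Network n) (w : Word (2 + n)) →
  Fixes w (select g h) → Fixes (below (below w)) h
fixes-select-right g h =
  Selected.fixes-select g h false true h (λ x → zipWith-mux-right (g x) (h x))

fires : Word n → Config n → Fin n → Bool
fires []      x a = false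
fires (b ∷ s) x a = does (a ≟ b) ∨ (lookup x b ∧ fires s x a)

chain : Word n → Network n
chain s x = tabulate (fires s x)

fires-monotone : (s : Word n) {x y : Config n} → x ⊑ y → ∀ a → fires s x a Bool.≤ fires s y a
fires-monotone []      x⊑y a = b≤b
fires-monotone (b ∷ s) x⊑y a = ∨-mono (b≤b {does (a ≟ b)}) (∧-mono (x⊑y b) (fires-monotone s x⊑y a))

chain-monotone : (s : Word n) → Monotone (chain s)
chain-monotone s x y x⊑y i
  rewrite Vec.lookup∘tabulate (fires s x) i | Vec.lookup∘tabulate (fires s y) i
  = fires-monotone s x⊑y i

-- U is the reversed prefix of letters already consumed, so that moving one letter from s to U
-- leaves U ʳ++ s definitionally unchanged.
data Fresh {n} (U : Word n) : Word n → Set where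
  []  : Fresh U []
  _∷_ : ∀ {b s} → b ∉ U → Fresh (b ∷ U) s → Fresh U (b ∷ s)

fires-∷ : ∀ b (s : Word n) x a → fires (b ∷ s) x a ≡ true → a ≡ b ⊎ (lookup x b ≡ true × fires s x a ≡ true)
fires-∷ b s x a eq with a ≟ b | lookup x b
... | yes a≡b | _    = inj₁ a≡b
... | no _    | true = inj₂ (refl , eq)

fires-here : ∀ b (s : Word n) x → fires (b ∷ s) x b ≡ true
fires-here b s x with b ≟ b
... | yes _   = refl
... | no b≢b = contradiction refl b≢b

fires-there : ∀ b (s : Word n) x a → lookup x b ≡ true → fires s x a ≡ true → fires (b ∷ s) x a ≡ true
fires-there b s x a xb eq rewrite xb | eq = Bool.∨-zeroʳ (does (a ≟ b))

fires-ʳ++⁻ : ∀ U (s : Word n) x a → fires (U ʳ++ s) x a ≡ true → a ∈ U ⊎ fires s x a ≡ true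
fires-ʳ++⁻ []      s x a eq = inj₂ eq
fires-ʳ++⁻ (b ∷ U) s x a eq with fires-ʳ++⁻ U (b ∷ s) x a eq
... | inj₁ a∈U = inj₁ (there a∈U)
... | inj₂ eq′ with fires-∷ b s x a eq′
...   | inj₁ a≡b        = inj₁ (here a≡b)
...   | inj₂ (_ , eq″) = inj₂ eq″

fires-ʳ++⁺ : ∀ U (s : Word n) x a → All (λ b → lookup x b ≡ true) U →
  fires s x a ≡ true → fires (U ʳ++ s) x a ≡ true
fires-ʳ++⁺ []      s x a []        eq = eq
fires-ʳ++⁺ (b ∷ U) s x a (xb ∷ xs) eq = fires-ʳ++⁺ U (b ∷ s) x a xs (fires-there b s x a xb eq)

-- Induction along the sequence: once all letters before `b` are on, `b` fires, and a fixed point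
-- must agree with that.
chain-fixed : ∀ U (s : Word n) x → FixedPoint (chain (U ʳ++ s)) x →
  All (λ b → lookup x b ≡ true) U → All (λ b → lookup x b ≡ true) s
chain-fixed U []      x fixed xs = []
chain-fixed U (b ∷ s) x fixed xs = xb ∷ chain-fixed (b ∷ U) s x fixed (xb ∷ xs)
  where
  xb : lookup x b ≡ true
  xb = trans (sym (cong (λ y → lookup y b) fixed))
    (trans (Vec.lookup∘tabulate (fires (U ʳ++ (b ∷ s)) x) b)
           (fires-ʳ++⁺ U (b ∷ s) x b xs (fires-here b s x)))

all-ʳ++ : ∀ {P : Fin n → Set} U {s} → All P (U ʳ++ s) → All P s
all-ʳ++ []      ps = ps
all-ʳ++ (b ∷ U) ps with _ ∷ qs ← all-ʳ++ U ps = qs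

-- The invariant while reading `w` is that only letters of `U` are on. Reading the awaited letter
-- `b` moves it into `U`. Any other letter can switch on only a member of `U`, since everything
-- after `b` in the sequence is blocked while `b` is off.
fixed⇒⊆ : ∀ U (s : Word n) → Fresh U s → ∀ w x → (∀ a → lookup x a ≡ true → a ∈ U) →
  FixedPoint (chain (U ʳ++ s)) (updates (chain (U ʳ++ s)) w x) → s ⊆ w
fixed⇒⊆ U []      fresh w       x x⊑U fixed = minimum w
-- No letters remain, so `x` itself is fixed and has the whole sequence on, including `b`, which the
-- invariant keeps off.
fixed⇒⊆ U (b ∷ s) (b∉U ∷ fresh) []      x x⊑U fixed =
  contradiction (x⊑U b xb) b∉U
  where
  xb : lookup x b ≡ true
  xb with p ∷ _ ← all-ʳ++ U (chain-fixed [] (U ʳ++ (b ∷ s)) x fixed []) = p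
fixed⇒⊆ U (b ∷ s) (b∉U ∷ fresh) (a ∷ w) x x⊑U fixed with a ≟ b
... | yes refl = refl ∷ fixed⇒⊆ (b ∷ U) s fresh w _ x′⊑bU fixed
  where
  x′⊑bU : ∀ c → lookup (update (chain (U ʳ++ (b ∷ s))) b x) c ≡ true → c ∈ b ∷ U
  x′⊑bU c eq with lookup-update (chain (U ʳ++ (b ∷ s))) b c x
  ... | inj₁ (b≡c , _) = here (sym b≡c)
  ... | inj₂ (_ , eq′) = there (x⊑U c (trans (sym eq′) eq))
... | no a≢b = a ∷ʳ fixed⇒⊆ U (b ∷ s) (b∉U ∷ fresh) w _ x′⊑U fixed
  where
  x′⊑U : ∀ c → lookup (update (chain (U ʳ++ (b ∷ s))) a x) c ≡ true → c ∈ U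
  x′⊑U c eq with lookup-update (chain (U ʳ++ (b ∷ s))) a c x
  ... | inj₂ (_ , eq′)    = x⊑U c (trans (sym eq′) eq)
  ... | inj₁ (refl , eq′)
    with fires-ʳ++⁻ U (b ∷ s) x a
           (trans (sym (Vec.lookup∘tabulate (fires (U ʳ++ (b ∷ s)) x) a)) (trans (sym eq′) eq))
  ...   | inj₁ a∈U = a∈U
  ...   | inj₂ eq″ with fires-∷ b s x a eq″
  ...     | inj₁ a≡b      = contradiction a≡b a≢b
  ...     | inj₂ (xb , _) = contradiction (x⊑U b xb) b∉U

fixes-chain⇒⊆ : ∀ (s : Word n) → Fresh [] s → ∀ w → Fixes w (chain s) → s ⊆ w
fixes-chain⇒⊆ s fresh w fixes = fixed⇒⊆ [] s fresh w (Vec.replicate _ false)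
  (λ a eq → contradiction (trans (sym (Vec.lookup-replicate a false)) eq) λ ()) (fixes _)

-- Trees of chains

data Tree (A : Set) : ℕ → Set where
  leaf : A → Tree A 0
  node : Tree A m → Tree A m → Tree A (suc m)

FreshWord : ℕ → Set
FreshWord n = Σ[ s ∈ Word n ] Fresh [] s

-- Both subtrees run on the same components, controls included. A further level therefore costs only
-- two components while it doubles the number of chains.
network : Tree (FreshWord n) m → Network (m * 2 + n)
network (leaf (s , _)) = chain s
network (node l r)     = select (network l) (network r)

network-monotone : (T : Tree (FreshWord n) m) → Monotone (network T)
network-monotone (leaf (s , _)) = chain-monotone s
network-monotone (node l r)     = select-monotone (network-monotone l) (network-monotone r)

project : ∀ m → Word (m * 2 + n) → Word n
project zero    w = w
project (suc m) w = project m (below (below w))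

length-project : ∀ m (w : Word (m * 2 + n)) → length (project m w) ≤ length w
length-project zero    w = ≤-refl
length-project (suc m) w =
  ≤-trans (length-project m _) (≤-trans (length-below (below w)) (length-below w))

survivors : Tree (FreshWord n) m → List (Word n) → List (Word n)
survivors (leaf (s , _)) W = filter (s ⊆?_) W
survivors (node l r)     W = survivors r (survivors l W)

-- Setting the controls along the path to a leaf turns the network into the chain of that leaf. A
-- word fixing the network must thus, after deletion of the control letters, contain the sequence of
-- every leaf.
fixes⇒survives : (T : Tree (FreshWord n) m) (w : Word (m * 2 + n)) {W : List (Word n)} →
  Fixes w (network T) → project m w ∈ W → project m w ∈ survivors T W
fixes⇒survives (leaf (s , fresh)) w fixes w∈W = ∈-filter⁺ (s ⊆?_) w∈W (fixes-chain⇒⊆ s fresh w fixes)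
fixes⇒survives (node l r) w fixes w∈W =
  fixes⇒survives r (below (below w)) (fixes-select-right (network l) (network r) w fixes)
    (fixes⇒survives l (below (below w)) (fixes-select-left (network l) (network r) w fixes) w∈W)

-- Sequences missed by many words

module _ {A : Set} {P : A → Set} (P? : Decidable P) where

  length-filter-split : ∀ xs → length xs ≡ length (filter P? xs) + length (filter (¬? ∘ P?) xs)
  length-filter-split []       = refl
  length-filter-split (x ∷ xs) with P? x
  ... | yes _ = cong suc (length-filter-split xs)
  ... | no _  = trans (cong suc (length-filter-split xs)) (sym (+-suc _ _))

  length-filter-mono : {Q : A → Set} (Q? : Decidable Q) → ∀ {xs} → All (λ x → P x → Q x) xs →
    length (filter P? xs) ≤ length (filter Q? xs)
  length-filter-mono Q? {[]}     []       = z≤n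
  length-filter-mono Q? {x ∷ xs} (i ∷ is) with P? x | Q? x
  ... | yes p | yes _ = s≤s (length-filter-mono Q? is)
  ... | yes p | no ¬q = contradiction (i p) ¬q
  ... | no _  | yes _ = m≤n⇒m≤1+n (length-filter-mono Q? is)
  ... | no _  | no _  = length-filter-mono Q? is

occurrences : Fin n → Word n → ℕ
occurrences b w = length (filter (b ≟_) w)

occurrences-zero : (w : Word (suc n)) → occurrences zero w + length (below w) ≡ length w
occurrences-zero []          = refl
occurrences-zero (zero ∷ w)  = cong suc (occurrences-zero w)
occurrences-zero (suc i ∷ w) = trans (+-suc _ _) (cong suc (occurrences-zero w))

occurrences-suc : (b : Fin n) (w : Word (suc n)) → occurrences (suc b) w ≡ occurrences b (below w)
occurrences-suc b []          = refl
occurrences-suc b (zero ∷ w)  = occurrences-suc b w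
occurrences-suc b (suc i ∷ w) with b ≟ i
... | yes refl = cong suc (occurrences-suc b w)
... | no _     = occurrences-suc b w

-- Averaging, by induction on the alphabet: if letter `zero` is not rare, its occurrences use up at
-- least one share `suc k` of the budget, and the other letters inherit the rest. The strict
-- inequality excludes the empty alphabet.
rare-letter : (w : Word n) → ∀ k → 2 * length w < n * suc k → ∃[ b ] 2 * occurrences b w ≤ k
rare-letter {suc n} w k few with 2 * occurrences zero w ≤? k
... | yes rare = zero , rare
... | no ¬rare =
  let b , rare = rare-letter (below w) k (+-cancelˡ-< (suc k) _ _ (begin-strict
        suc k + 2 * length (below w)                    ≤⟨ +-monoˡ-≤ _ (≰⇒> ¬rare) ⟩
        2 * occurrences zero w + 2 * length (below w)   ≡⟨ *-distribˡ-+ 2 (occurrences zero w) _ ⟨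
        2 * (occurrences zero w + length (below w))     ≡⟨ cong (2 *_) (occurrences-zero w) ⟩
        2 * length w                                    <⟨ few ⟩
        suc k + n * suc k                               ∎))
  in suc b , subst (λ o → 2 * o ≤ k) (sym (occurrences-suc b w)) rare
  where open ≤-Reasoning

_∈?_ : (b : Fin n) (w : Word n) → Dec (b ∈ w)
_∈?_ = DecMembership._∈?_ _≟_

∈⇒occurs : ∀ {b : Fin n} {w} → b ∈ w → 1 ≤ occurrences b w
∈⇒occurs {b = b} {c ∷ w} b∈ with b ≟ c | b∈
... | yes _   | _            = s≤s z≤n
... | no b≢c | here b≡c     = contradiction b≡c b≢c
... | no _    | there b∈w    = ∈⇒occurs b∈w

hits≤occurrences : {A : Set} (g : A → Word n) (b : Fin n) → ∀ xs →
  length (filter (λ x → b ∈? g x) xs) ≤ occurrences b (concatMap g xs)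
hits≤occurrences g b []       = z≤n
hits≤occurrences g b (x ∷ xs)
  rewrite filter-++ (b ≟_) (g x) (concatMap g xs)
        | length-++ (filter (b ≟_) (g x)) {filter (b ≟_) (concatMap g xs)}
  with b ∈? g x
... | yes b∈ = +-mono-≤ (∈⇒occurs b∈) (hits≤occurrences g b xs)
... | no _   = ≤-trans (hits≤occurrences g b xs) (m≤n+m _ _)

length-concatMap : {A : Set} (g : A → Word n) → ∀ k → (∀ x → length (g x) ≤ k) →
  ∀ xs → length (concatMap g xs) ≤ length xs * k
length-concatMap g k g≤k []       = z≤n
length-concatMap g k g≤k (x ∷ xs) rewrite length-++ (g x) {concatMap g xs} =
  +-mono-≤ (g≤k x) (length-concatMap g k g≤k xs)

-- Here `g x` lists the letters forbidden by `x`. These lists have total length at most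
-- `length xs * k`, so some letter occurs in them at most `length xs / 2` times and is forbidden by
-- at most half of the `xs`.
avoided-letter : {A : Set} (g : A → Word n) → ∀ k → (∀ x → length (g x) ≤ k) →
  0 < n → 2 * k ≤ n → ∀ xs →
  ∃[ b ] length xs ≤ 2 * length (filter (¬? ∘ (λ x → b ∈? g x)) xs)
avoided-letter {n} g k g≤k n>0 2k≤n xs =
  let b , rare = rare-letter (concatMap g xs) (length xs) (begin-strict
        2 * length (concatMap g xs)  ≤⟨ *-monoʳ-≤ 2 (length-concatMap g k g≤k xs) ⟩
        2 * (length xs * k)          ≡⟨ swap (length xs) k ⟩
        2 * k * length xs            ≤⟨ *-monoˡ-≤ (length xs) 2k≤n ⟩
        n * length xs                <⟨ m<n+m (n * length xs) n>0 ⟩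
        n + n * length xs            ≡⟨ *-suc n (length xs) ⟨
        n * suc (length xs)          ∎)
      hit  = length (filter (λ x → b ∈? g x) xs)
      miss = length (filter (¬? ∘ (λ x → b ∈? g x)) xs)
  in b , +-cancelˡ-≤ (2 * hit) (length xs) (2 * miss) (begin
        2 * hit + length xs    ≤⟨ +-monoˡ-≤ (length xs)
                                   (≤-trans (*-monoʳ-≤ 2 (hits≤occurrences g b xs)) rare) ⟩
        length xs + length xs  ≡⟨ cong (λ k → length xs + k) (+-identityʳ (length xs)) ⟨
        2 * length xs          ≡⟨ cong (2 *_) (length-filter-split (λ x → b ∈? g x) xs) ⟩
        2 * (hit + miss)       ≡⟨ *-distribˡ-+ 2 hit miss ⟩
        2 * hit + 2 * miss     ∎)
  where
  open ≤-Reasoning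
  swap : ∀ l k → 2 * (l * k) ≡ 2 * k * l
  swap = solve-∀

after : Fin n → Word n → Word n
after b []      = []
after b (a ∷ w) with b ≟ a
... | yes _ = w
... | no _  = after b w

-- Greedy matching: any embedding of `b ∷ s` can be changed to use the first occurrence of `b`.
∷⊆⇒⊆after : ∀ (b : Fin n) {s} w → b ∷ s ⊆ w → s ⊆ after b w
∷⊆⇒⊆after b (a ∷ w) p with b ≟ a | p
... | yes _    | _ ∷ s⊆w    = s⊆w
-- The embedding skips the first `b`; all of `b ∷ s`, and so `s`, fits behind it.
... | yes refl | a ∷ʳ bs⊆w  = ∷ˡ⁻ bs⊆w
... | no b≢a   | b≡a ∷ _    = contradiction b≡a b≢a
... | no _     | a ∷ʳ bs⊆w  = ∷⊆⇒⊆after b w bs⊆w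

length-after : ∀ (b : Fin n) w k → b ∉ take k w → length (after b w) ≤ length w ∸ k
length-after b w       zero    _  = length-after-≤ w
  where
  length-after-≤ : ∀ w → length (after b w) ≤ length w
  length-after-≤ []      = z≤n
  length-after-≤ (a ∷ w) with b ≟ a
  ... | yes _ = n≤1+n _
  ... | no _  = m≤n⇒m≤1+n (length-after-≤ w)
length-after b []      (suc k) _  = z≤n
length-after b (a ∷ w) (suc k) b∉ with b ≟ a
... | yes b≡a = contradiction (here b≡a) b∉
... | no _    = length-after b w k (b∉ ∘ there)

filter-nonempty : {A : Set} {P : A → Set} (P? : Decidable P) → ∀ xs →
  0 < length (filter P? xs) → ∃[ x ] P x
filter-nonempty P? xs 0< with filter P? xs in eq | 0<
... | x ∷ _ | _ = x , proj₂ (∈-filter⁻ P? {xs = xs} (subst (x ∈_) (sym eq) (here refl)))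

length-filter-map-filter : {A : Set} {P Q R : A → Set} (P? : Decidable P) (Q? : Decidable Q) (R? : Decidable R)
  (h : A → A) → (∀ x → P x → Q (h x) → R x) → ∀ xs →
  length (filter Q? (map h (filter P? xs))) ≤ length (filter R? xs)
length-filter-map-filter P? Q? R? h imp []       = z≤n
length-filter-map-filter P? Q? R? h imp (x ∷ xs) with P? x
... | no _ with R? x
...   | yes _ = m≤n⇒m≤1+n (length-filter-map-filter P? Q? R? h imp xs)
...   | no _  = length-filter-map-filter P? Q? R? h imp xs
length-filter-map-filter P? Q? R? h imp (x ∷ xs) | yes p with Q? (h x) | R? x
...   | yes _ | yes _ = s≤s (length-filter-map-filter P? Q? R? h imp xs)
...   | yes q | no ¬r = contradiction (imp x p q) ¬r
...   | no _  | yes _ = m≤n⇒m≤1+n (length-filter-map-filter P? Q? R? h imp xs)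
...   | no _  | no _  = length-filter-map-filter P? Q? R? h imp xs

module _ (q : ℕ) (q>0 : 0 < q) where

  missed : Word (4 * q) → List (Word (4 * q)) → List (Word (4 * q))
  missed s = filter (¬? ∘ (s ⊆?_))

  avoids? : (U : Word (4 * q)) (b : Fin (4 * q)) → Decidable (λ w → ¬ b ∈ U ++ take q w)
  avoids? U b w = ¬? (b ∈? (U ++ take q w))

  -- Each word forbids at most `q` used letters and its own next `q` letters. Avoiding half of the
  -- words needs an alphabet twice that large, whence the `4 * q` letters.
  fresh-letter : ∀ U → length U ≤ q → ∀ w W →
    ∃[ b ] (b ∉ U × length (w ∷ W) ≤ 2 * length (filter (avoids? U b) (w ∷ W)))
  fresh-letter U U≤q w W =
    let b , half = avoided-letter (λ v → U ++ take q v) (q + q)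
          (λ v → ≤-trans (≤-reflexive (length-++ U))
                   (+-mono-≤ U≤q (≤-trans (≤-reflexive (length-take q v)) (m⊓n≤m q _))))
          (≤-trans q>0 (m≤n*m q 4)) (≤-reflexive (double q)) (w ∷ W)
        -- At least half of a nonempty list is kept, so some word `v` is. Every forbidden list
        -- contains `U`, so this one word already shows `b ∉ U`.
        v , b∉ = filter-nonempty (avoids? U b) (w ∷ W) (*-cancelˡ-< 2 0 _ (<-≤-trans z<s half))
    in b , (b∉ ∘ ∈-++⁺ˡ) , half
    where
    double : ∀ q → 2 * (q + q) ≡ 4 * q
    double = solve-∀

  -- Each round adds a letter to the sequence, keeps at least half of the words, and replaces each
  -- kept word by its suffix after that letter, which is shorter by at least `q` unless already
  -- empty. After `r` rounds only empty suffixes remain, and one more letter is missed by all of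
  -- them: `suc r` halvings in total.
  missed-word : ∀ r U W → length U + r ≤ q → All (λ w → length w ≤ r * q) W →
    ∃[ s ] (Fresh U s × length W ≤ 2 ^ suc r * length (missed s W))
  missed-word r U [] _ _ = [] , [] , z≤n
  missed-word zero U W@(w ∷ W′) U≤q short =
    let b , b∉U , half = fresh-letter U (m+n≤o⇒m≤o _ U≤q) w W′
    in b ∷ [] , b∉U ∷ [] ,
       ≤-trans half (*-monoʳ-≤ 2 (length-filter-mono (avoids? U b) (¬? ∘ ((b ∷ []) ⊆?_)) {W}
         (All.map (λ { {[]} _ _ () }) short)))
  missed-word (suc r) U W@(w ∷ W′) U≤q short =
    let b , b∉U , half  = fresh-letter U (m+n≤o⇒m≤o _ U≤q) w W′
        F               = filter (avoids? U b) W
        s , fresh , few = missed-word r (b ∷ U) (map (after b) F)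
          (≤-trans (≤-reflexive (sym (+-suc (length U) r))) U≤q)
          (All.map⁺ (All.map (λ {v} (v≤ , b∉) → ≤-trans (length-after b v q (b∉ ∘ ∈-++⁺ʳ U))
                       (≤-trans (∸-monoˡ-≤ q v≤) (≤-reflexive (m+n∸m≡n q (r * q)))))
             (All.zip (All.filter⁺ (avoids? U b) short , All.all-filter (avoids? U b) W))))
    in b ∷ s , b∉U ∷ fresh , (begin
       length W                                            ≤⟨ half ⟩
       2 * length F                                        ≡⟨ cong (2 *_) (length-map (after b) F) ⟨
       2 * length (map (after b) F)                        ≤⟨ *-monoʳ-≤ 2 few ⟩
       2 * (2 ^ suc r * length (missed s (map (after b) F)))
         -- A kept word whose suffix after `b` misses `s` itself misses `b ∷ s`.
         ≤⟨ *-monoʳ-≤ 2 (*-monoʳ-≤ (2 ^ suc r) (length-filter-map-filter (avoids? U b)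
              (¬? ∘ (s ⊆?_)) (¬? ∘ ((b ∷ s) ⊆?_)) (after b)
              (λ v _ s⊈ bs⊆ → s⊈ (∷⊆⇒⊆after b v bs⊆)) W)) ⟩
       2 * (2 ^ suc r * length (missed (b ∷ s) W))          ≡⟨ *-assoc 2 (2 ^ suc r) _ ⟨
       2 ^ suc (suc r) * length (missed (b ∷ s) W)          ∎)
    where open ≤-Reasoning

-- Counting short words, and elementary inequalities

length-cartesianProductWith : {A B C : Set} (f : A → B → C) → ∀ xs ys →
  length (cartesianProductWith f xs ys) ≡ length xs * length ys
length-cartesianProductWith f []       ys = refl
length-cartesianProductWith f (x ∷ xs) ys = trans (length-++ (map (f x) ys))
  (cong₂ _+_ (length-map (f x) ys) (length-cartesianProductWith f xs ys))

words : ∀ n → ℕ → List (Word n)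
words n zero    = [] ∷ []
words n (suc k) = [] ∷ cartesianProductWith _∷_ (allFin n) (words n k)

∈-words : ∀ k (w : Word n) → length w ≤ k → w ∈ words n k
∈-words zero    []      _        = here refl
∈-words (suc k) []      _        = here refl
∈-words (suc k) (i ∷ w) (s≤s w≤) =
  there (∈-cartesianProductWith⁺ _∷_ (∈-allFin i) (∈-words k w w≤))

words-short : ∀ n k → All (λ w → length w ≤ k) (words n k)
words-short n zero    = z≤n ∷ []
words-short n (suc k) = z≤n ∷
  All.cartesianProductWith⁺ (setoid _) (setoid _) _∷_ (allFin n) (words n k)
    λ _ w∈ → s≤s (All.lookup (words-short n k) w∈)

length-words : ∀ n k → length (words n k) ≤ suc n ^ k
length-words n zero    = ≤-refl
length-words n (suc k) = begin
  suc (length (cartesianProductWith _∷_ (allFin n) (words n k)))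
    ≡⟨ cong suc (length-cartesianProductWith _∷_ (allFin n) (words n k)) ⟩
  suc (length (allFin n) * length (words n k))
    ≡⟨ cong (λ l → suc (l * length (words n k))) (length-tabulate {n = n} (λ i → i)) ⟩
  suc (n * length (words n k))                  ≤⟨ +-mono-≤ (m^n>0 (suc n) k) (*-monoʳ-≤ n (length-words n k)) ⟩
  suc n ^ suc k                                 ∎
  where open ≤-Reasoning

n<2^n : ∀ n → n < 2 ^ n
n<2^n zero    = s≤s z≤n
n<2^n (suc n) = begin-strict
  suc n            ≤⟨ n<2^n n ⟩
  2 ^ n            <⟨ m<m+n (2 ^ n) (≤-trans (m^n>0 2 n) (m≤m+n _ 0)) ⟩
  2 ^ n + (2 ^ n + 0) ∎
  where open ≤-Reasoning

-- The count is at most `2 ^ (4q³)`, and `q < 2 ^ q` bounds this exponent. The bound is crude, but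
-- `3 + 3 * q` is linear in `q`, as the depth of the tree has to be.
length-words<2^2^ : ∀ q → length (words (4 * q) (q * q)) < 2 ^ 2 ^ (3 + 3 * q)
length-words<2^2^ q = begin-strict
  length (words (4 * q) (q * q))  ≤⟨ length-words (4 * q) (q * q) ⟩
  suc (4 * q) ^ (q * q)           ≤⟨ ^-monoˡ-≤ (q * q) (n<2^n (4 * q)) ⟩
  (2 ^ (4 * q)) ^ (q * q)         ≡⟨ ^-*-assoc 2 (4 * q) (q * q) ⟩
  2 ^ (4 * q * (q * q))           <⟨ ^-monoʳ-< 2 (s≤s (s≤s z≤n)) exponent ⟩
  2 ^ 2 ^ (3 + 3 * q)             ∎
  where
  open ≤-Reasoning
  cube : ∀ a → 4 * a * (a * a) ≡ 4 * (a * (a * (a * 1)))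
  cube = solve-∀
  exponent : 4 * q * (q * q) < 2 ^ (3 + 3 * q)
  exponent = begin-strict
    4 * q * (q * q)    ≡⟨ cube q ⟩
    4 * q ^ 3          ≤⟨ *-monoʳ-≤ 4 (^-monoˡ-≤ 3 (<⇒≤ (n<2^n q))) ⟩
    4 * (2 ^ q) ^ 3
      <⟨ *-monoˡ-< ((2 ^ q) ^ 3) {{m^n≢0 (2 ^ q) 3 {{m^n≢0 2 q}}}} (m<m+n 4 {4} z<s) ⟩
    8 * (2 ^ q) ^ 3    ≡⟨ cong (8 *_) (trans (^-*-assoc 2 q 3) (cong (2 ^_) (*-comm q 3))) ⟩
    2 ^ 3 * 2 ^ (3 * q) ≡⟨ ^-distribˡ-+-* 2 3 (3 * q) ⟨
    2 ^ (3 + 3 * q)    ∎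

-- Bernoulli's inequality `1 + k/a ≤ (1 + 1/a)^k` with denominators cleared.
bernoulli : ∀ a k → a ^ k * (a + k) ≤ a * suc a ^ k
bernoulli a zero    = ≤-reflexive (simp a)
  where
  simp : ∀ a → 1 * (a + 0) ≡ a * 1
  simp = solve-∀
bernoulli a (suc k) = begin
  a * a ^ k * (a + suc k)          ≤⟨ m≤m+n _ (a ^ k * k) ⟩
  a * a ^ k * (a + suc k) + a ^ k * k ≡⟨ regroup a k (a ^ k) ⟩
  suc a * (a ^ k * (a + k))        ≤⟨ *-monoʳ-≤ (suc a) (bernoulli a k) ⟩
  suc a * (a * suc a ^ k)          ≡⟨ swap (suc a) a (suc a ^ k) ⟩
  a * (suc a * suc a ^ k)          ∎
  where
  open ≤-Reasoning
  regroup : ∀ a k p → a * p * (a + suc k) + p * k ≡ suc a * (p * (a + k))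
  regroup = solve-∀
  swap : ∀ x y z → x * (y * z) ≡ y * (x * z)
  swap = solve-∀

-- With `A = suc a` this says `(a/A)^A ≤ 1/2`: a batch of `A` leaves at least halves the number of
-- surviving words.
2*a^A≤A^A : ∀ a → 0 < a → 2 * a ^ suc a ≤ suc a ^ suc a
2*a^A≤A^A a a>0 = *-cancelˡ-≤ a {{>-nonZero a>0}} (begin
  a * (2 * a ^ suc a)     ≤⟨ m≤m+n _ (a ^ suc a) ⟩
  a * (2 * a ^ suc a) + a ^ suc a ≡⟨ regroup a (a ^ suc a) ⟩
  a ^ suc a * (a + suc a) ≤⟨ bernoulli a (suc a) ⟩
  a * suc a ^ suc a       ∎)
  where
  open ≤-Reasoning
  regroup : ∀ a p → a * (2 * p) + p ≡ p * (a + suc a)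
  regroup = solve-∀

-- Networks with quadratic fixing length

survivors-all : {P : Word n → Set} (T : Tree (FreshWord n) m) {W : List (Word n)} →
  All P W → All P (survivors T W)
survivors-all (leaf (s , _)) ps = All.filter⁺ (s ⊆?_) ps
survivors-all (node l r)     ps = survivors-all r (survivors-all l ps)

module _ (q : ℕ) (q>0 : 0 < q) (a : ℕ) (A≡2^ : suc a ≡ 2 ^ suc q) where

  -- Each leaf keeps at most the fraction a / (1 + a) of the words, and the right subtree is chosen for
  -- the words left over by the left one, so the fraction is squared from one level to the next.
  few-survivors : ∀ m W → All (λ w → length w ≤ q * q) W →
    Σ[ T ∈ Tree (FreshWord (4 * q)) m ] length (survivors T W) * suc a ^ (2 ^ m) ≤ length W * a ^ (2 ^ m)
  few-survivors zero W short with s , fresh , many ← missed-word q q>0 q [] W ≤-refl short =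
    leaf (s , fresh) , (begin
      caught * (suc a * 1)             ≡⟨ expand caught a ⟩
      caught + caught * a              ≤⟨ +-monoˡ-≤ (caught * a) caught≤ ⟩
      a * miss + caught * a            ≡⟨ collect a miss caught ⟩
      (caught + miss) * (a * 1)        ≡⟨ cong (_* (a * 1)) split ⟨
      length W * (a * 1)               ∎)
    where
    open ≤-Reasoning
    caught = length (filter (s ⊆?_) W)
    miss   = length (missed q q>0 s W)
    split : length W ≡ caught + miss
    split = length-filter-split (s ⊆?_) W
    expand : ∀ c a → c * (suc a * 1) ≡ c + c * a
    expand = solve-∀
    collect : ∀ a m c → a * m + c * a ≡ (c + m) * (a * 1)
    collect = solve-∀
    caught≤ : caught ≤ a * miss
    caught≤ = +-cancelˡ-≤ miss caught (a * miss) (begin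
      miss + caught      ≡⟨ trans (+-comm miss caught) (sym split) ⟩
      length W           ≤⟨ many ⟩
      2 ^ suc q * miss   ≡⟨ cong (_* miss) A≡2^ ⟨
      miss + a * miss    ∎)
  few-survivors (suc m) W short
    with l , few-l ← few-survivors m W short
    with r , few-r ← few-survivors m (survivors l W) (survivors-all l short) =
    node l r , (begin
      length (survivors r (survivors l W)) * suc a ^ (2 ^ suc m)
        ≡⟨ cong (length (survivors r (survivors l W)) *_) (square (suc a)) ⟩
      length (survivors r (survivors l W)) * (suc a ^ (2 ^ m) * suc a ^ (2 ^ m))
        ≡⟨ *-assoc (length (survivors r (survivors l W))) _ _ ⟨
      length (survivors r (survivors l W)) * suc a ^ (2 ^ m) * suc a ^ (2 ^ m)
        ≤⟨ *-monoˡ-≤ (suc a ^ (2 ^ m)) few-r ⟩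
      length (survivors l W) * a ^ (2 ^ m) * suc a ^ (2 ^ m)
        ≡⟨ swap (length (survivors l W)) (a ^ (2 ^ m)) (suc a ^ (2 ^ m)) ⟩
      length (survivors l W) * suc a ^ (2 ^ m) * a ^ (2 ^ m)
        ≤⟨ *-monoˡ-≤ (a ^ (2 ^ m)) few-l ⟩
      length W * a ^ (2 ^ m) * a ^ (2 ^ m)
        ≡⟨ *-assoc (length W) _ _ ⟩
      length W * (a ^ (2 ^ m) * a ^ (2 ^ m))
        ≡⟨ cong (length W *_) (square a) ⟨
      length W * a ^ (2 ^ suc m) ∎)
    where
    open ≤-Reasoning
    swap : ∀ x y z → x * y * z ≡ x * z * y
    swap = solve-∀
    square : ∀ b → b ^ (2 ^ suc m) ≡ b ^ (2 ^ m) * b ^ (2 ^ m)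
    square b = trans (cong (λ e → b ^ (2 ^ m + e)) (+-identityʳ (2 ^ m))) (^-distribˡ-+-* b (2 ^ m) (2 ^ m))

  -- The tree has `A * 2 ^ (3 + 3 * q)` leaves with `A = 2 ^ suc q`. Each batch of `A` leaves halves
  -- the bound on the survivors, and `2 ^ (3 + 3 * q)` halvings exhaust fewer than
  -- `2 ^ 2 ^ (3 + 3 * q)` words.
  depth : ℕ
  depth = suc q + (3 + 3 * q)

  no-survivors : ∀ W → All (λ w → length w ≤ q * q) W → length W < 2 ^ 2 ^ (3 + 3 * q) →
    Σ[ T ∈ Tree (FreshWord (4 * q)) depth ] survivors T W ≡ []
  no-survivors W short W<
    with T , few ← few-survivors depth W short =
    -- Cancelling `2 ^ M * X ^ M` leaves fewer than one survivor.
    T , empty (survivors T W) (*-cancelʳ-< (2 ^ M * X ^ M) _ 1 (begin-strict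
      length (survivors T W) * (2 ^ M * X ^ M)
        ≡⟨ cong (length (survivors T W) *_) (^-distribʳ-* M 2 X) ⟨
      length (survivors T W) * (2 * X) ^ M
        ≤⟨ *-monoʳ-≤ (length (survivors T W)) (^-monoˡ-≤ M (2*a^A≤A^A a a>0)) ⟩
      length (survivors T W) * (suc a ^ suc a) ^ M  ≡⟨ cong (length (survivors T W) *_) (power (suc a)) ⟨
      length (survivors T W) * suc a ^ 2 ^ depth    ≤⟨ few ⟩
      length W * a ^ 2 ^ depth                      ≡⟨ cong (length W *_) (power a) ⟩
      length W * X ^ M
        <⟨ *-monoˡ-< (X ^ M) {{m^n≢0 X M {{m^n≢0 a (suc a) {{>-nonZero a>0}}}}}} W< ⟩
      2 ^ M * X ^ M                                 ≡⟨ *-identityˡ _ ⟨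
      1 * (2 ^ M * X ^ M)                           ∎))
    where
    open ≤-Reasoning
    M = 2 ^ (3 + 3 * q)
    X = a ^ suc a
    a>0 : 0 < a
    a>0 = s≤s⁻¹ (subst (2 ≤_) (sym A≡2^) (*-monoʳ-≤ 2 (m^n>0 2 q)))
    power : ∀ b → b ^ 2 ^ depth ≡ (b ^ suc a) ^ M
    power b = trans (cong (b ^_) (trans (^-distribˡ-+-* 2 (suc q) (3 + 3 * q)) (cong (_* M) (sym A≡2^))))
                    (sym (^-*-assoc b (suc a) M))
    ^-distribʳ-* : ∀ k x y → (x * y) ^ k ≡ x ^ k * y ^ k
    ^-distribʳ-* zero    x y = refl
    ^-distribʳ-* (suc k) x y =
      trans (cong (x * y *_) (^-distribʳ-* k x y)) ([m*n]*[o*p]≡[m*o]*[n*p] x y (x ^ k) (y ^ k))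
    empty : ∀ (V : List (Word (4 * q))) → length V < 1 → V ≡ []
    empty []      _         = refl
    empty (_ ∷ _) (s≤s ())

HardNetwork : ℕ → ℕ → Set
HardNetwork n k = Σ[ f ∈ Network n ] (Monotone f × (∀ w → Fixes w f → k ≤ length w))

-- Serves the small `n`: the zero configuration is not fixed, so the empty word fails.
constant-hard : 0 < n → HardNetwork n 1
constant-hard {suc n} _ = (λ _ → Vec.replicate _ true) , (λ _ _ _ _ → Bool.≤-refl) , λ where
  []      fixes → contradiction (fixes (Vec.replicate _ false)) λ ()
  (_ ∷ _) _     → s≤s z≤n

pad-hard : ∀ r {k} → HardNetwork n k → HardNetwork (r + n) k
pad-hard zero    hard = hard
pad-hard (suc r) hard with f , f-mono , bound ← pad-hard r hard =
  pad f , pad-monotone f-mono ,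
  λ w fixes → ≤-trans (bound (below w) (fixes-pad f w fixes)) (length-below w)

-- 4q components for the chains, and two controls for each of the 4q + 4 levels of the tree.
selection-hard : ∀ q → 0 < q → HardNetwork (12 * q + 8) (q * q)
selection-hard q q>0 =
  subst (λ n → HardNetwork n (q * q)) size
    (network T , network-monotone T , bound)
  where
  a = pred (2 ^ suc q)
  A≡2^ : suc a ≡ 2 ^ suc q
  A≡2^ = suc-pred (2 ^ suc q) {{m^n≢0 2 (suc q)}}
  W = words (4 * q) (q * q)
  d = suc q + (3 + 3 * q)
  covering : Σ[ T ∈ Tree (FreshWord (4 * q)) d ] survivors T W ≡ []
  covering = no-survivors q q>0 a A≡2^ W (words-short (4 * q) (q * q)) (length-words<2^2^ q)
  T = proj₁ covering
  bound : ∀ w → Fixes w (network T) → q * q ≤ length w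
  bound w fixes with q * q ≤? length w
  ... | yes q²≤ = q²≤
  ... | no ¬q²≤ = contradiction
    (subst (project d w ∈_) (proj₂ covering)
      (fixes⇒survives T w fixes
        (∈-words (q * q) (project d w) (≤-trans (length-project d w) (<⇒≤ (≰⇒> ¬q²≤))))))
    λ ()
  size : d * 2 + 4 * q ≡ 12 * q + 8
  size = regroup q
    where
    regroup : ∀ q → (suc q + (3 + 3 * q)) * 2 + 4 * q ≡ 12 * q + 8
    regroup = solve-∀

-- The size `12 * q + 8` is at least 20 for positive `q`. For larger `n` the remainder `r < 12` is
-- filled with idle components, so `n ≤ 12 * q + 20 ≤ 32 * q`.
quadratic-hard : ∀ n → 0 < n → ∃[ q ] (n ≤ 32 * q × HardNetwork n (q * q))
quadratic-hard n n>0 with 20 ≤? n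
... | no  n≱20 = 1 , ≤-trans (<⇒≤ (≰⇒> n≱20)) (m≤m+n 20 12) , constant-hard n>0
... | yes n≥20 = q , bound , subst (λ k → HardNetwork k (q * q)) size (pad-hard r (selection-hard q z<s))
  where
  open ≤-Reasoning
  p = (n ∸ 20) / 12
  r = (n ∸ 20) % 12
  q = suc p
  regroup : ∀ r p → r + (12 * suc p + 8) ≡ 20 + (r + p * 12)
  regroup = solve-∀
  size : r + (12 * q + 8) ≡ n
  size = begin-equality
    r + (12 * q + 8)     ≡⟨ regroup r p ⟩
    20 + (r + p * 12)    ≡⟨ cong (λ k → 20 + k) (m≡m%n+[m/n]*n (n ∸ 20) 12) ⟨
    20 + (n ∸ 20)        ≡⟨ m+[n∸m]≡n n≥20 ⟩
    n                    ∎
  spread : ∀ p → 12 + (12 * suc p + 8) + 20 * p ≡ 32 * suc p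
  spread = solve-∀
  bound : n ≤ 32 * q
  bound = begin
    n                          ≡⟨ size ⟨
    r + (12 * q + 8)           ≤⟨ +-monoˡ-≤ (12 * q + 8) (<⇒≤ (m%n<n (n ∸ 20) 12)) ⟩
    12 + (12 * q + 8)          ≤⟨ m≤m+n _ (20 * p) ⟩
    12 + (12 * q + 8) + 20 * p ≡⟨ spread p ⟩
    32 * q                     ∎

-- The comparison is made on unnormalised fractions, where it becomes one of integer cross products.
scale-≤ : ∀ d .{{_ : NonZero d}} k l → k ≤ d * l → (+ 1 ℚ./ d) ℚ.* (+ k ℚ./ 1) ℚ.≤ + l ℚ./ 1
scale-≤ d@(suc d′) k l k≤dl = ℚ.toℚᵘ-cancel-≤ (begin
  ℚ.toℚᵘ ((+ 1 ℚ./ d) ℚ.* (+ k ℚ./ 1))          ≃⟨ ℚ.toℚᵘ-homo-* (+ 1 ℚ./ d) (+ k ℚ./ 1) ⟩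
  ℚ.toℚᵘ (+ 1 ℚ./ d) ℚᵘ.* ℚ.toℚᵘ (+ k ℚ./ 1)
    ≃⟨ ℚᵘ.*-cong (ℚ.toℚᵘ-fromℚᵘ (ℚᵘ.mkℚᵘ (+ 1) d′)) (ℚ.toℚᵘ-fromℚᵘ (ℚᵘ.mkℚᵘ (+ k) 0)) ⟩
  ℚᵘ.mkℚᵘ (+ 1) d′ ℚᵘ.* ℚᵘ.mkℚᵘ (+ k) 0         ≤⟨ ℚᵘ.*≤* numerators ⟩
  ℚᵘ.mkℚᵘ (+ l) 0                               ≃⟨ ℚ.toℚᵘ-fromℚᵘ (ℚᵘ.mkℚᵘ (+ l) 0) ⟨
  ℚ.toℚᵘ (+ l ℚ./ 1)                            ∎)
  where
  open ℚᵘ.≤-Reasoning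
  numerators : (+ 1 ℤ.* + k) ℤ.* + 1 ℤ.≤ + l ℤ.* + (suc (0 + d′ * 1))
  numerators rewrite ℤ.*-identityˡ (+ k) | ℤ.*-identityʳ (+ k) | sym (ℤ.pos-* l (suc (d′ * 1)))
                   | *-identityʳ d′ = ℤ.+≤+ (subst (k ≤_) (*-comm d l) k≤dl)

theorem2 : ∃[ c ] (0ℚ ℚ.< c ×
    (∀ (n : ℕ) → 0 ℕ.< n →
    Σ[ f ∈ Network n ] (Monotone f ×
    ∃[ ℓ ] (IsFixingLength f ℓ × c ℚ.* (+ (n ℕ.^ 2) ℚ./ 1) ℚ.≤ + ℓ ℚ./ 1))))
theorem2 = + 1 ℚ./ 1024 , ℚ.*<* (ℤ.+<+ z<s) , λ n n>0 →
  let q , n≤32q , f , f-mono , bound = quadratic-hard n n>0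
      ℓ , isFixingLength             = monotone⇒fixingLength f f-mono
      (w , fixes , length≡ℓ) , _     = isFixingLength
  -- The constant is `1/32²`, from `n ≤ 32 * q` and `q * q ≤ ℓ`.
  in f , f-mono , ℓ , isFixingLength , scale-≤ 1024 (n ^ 2) ℓ (begin
       n ^ 2           ≤⟨ ^-monoˡ-≤ 2 n≤32q ⟩
       (32 * q) ^ 2    ≡⟨ square q ⟩
       1024 * (q * q)  ≤⟨ *-monoʳ-≤ 1024 (subst (q * q ≤_) length≡ℓ (bound w fixes)) ⟩
       1024 * ℓ        ∎)
  where
  open ≤-Reasoning
  square : ∀ q → (32 * q) * ((32 * q) * 1) ≡ 1024 * (q * q)
  square = solve-∀
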